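{- The logic $\mathsf{S4I}$ has the finite model property: for every formula $\varphi$, if $\mathsf{S4I}\nvdash\varphi$, then there is an $\mathsf{S4I}$-model $\mathcal M$ with finitely many worlds such that $\mathcal M\not\models\varphi$.
   Context: Fix a countably infinite set $\mathbb P$ of propositional variables. Formulas: $\varphi,\psi ::= p\mid\bot\mid(\varphi\wedge\psi)\mid(\varphi\vee\psi)\mid(\varphi\to\psi)\mid\Diamond\varphi\mid\Box\varphi$; $\neg\varphi:=\varphi\to\bot$. A bi-intuitionistic frame is $(W,W_\bot,\preccurlyeq,\sqsubseteq)$ with $\preccurlyeq,\sqsubseteq$ preorders on $W$ and $W_\bot\subseteq W$ upward closed under both; infallible if $W_\bot=\varnothing$. A valuation $V:\mathbb P\to 2^W$ has each $V(p)$ upward closed under $\preccurlyeq$ and containing $W_\bot$; a model is $\mathcal M=(W,W_\bot,\preccurlyeq,\sqsubseteq,V)$. Satisfaction: $p$ iff $w\in V(p)$; $\bot$ iff $w\in W_\bot$; $\wedge,\vee$ pointwise; $w\models\varphi\to\psi$ iff for all $v\succcurlyeq w$, $v\models\varphi$ implies $v\models\psi$; $w\models\Diamond\varphi$ iff for all $u\succcurlyeq w$ there is $v\sqsupseteq u$ with $v\models\varphi$; $w\models\Box\varphi$ iff $v\models\varphi$ whenever $w\preccurlyeq u\sqsubseteq v$. $\mathcal M\models\varphi$ iff $\varphi$ holds at every $w\in W\setminus W_\bot$. $\sqsubseteq$ is forward confluent if $w\preccurlyeq w'$ and $w\sqsubseteq v$ imply some $v'$ with $v\preccurlyeq v'$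 and $w'\sqsubseteq v'$; downward confluent if $w\preccurlyeq v\sqsubseteq v'$ implies some $w'$ with $w\sqsubseteq w'\preccurlyeq v'$. An $\mathsf{S4I}$-frame is an infallible bi-intuitionistic frame in which $\sqsubseteq$ is forward and downward confluent; an $\mathsf{S4I}$-model is a model on such a frame. $\mathsf{CS4}$ is the least set of formulas containing all intuitionistic propositional tautologies and all instances of $\Box(\varphi\to\psi)\to(\Box\varphi\to\Box\psi)$, $\Box(\varphi\to\psi)\to(\Diamond\varphi\to\Diamond\psi)$, $\Box\varphi\to\varphi$, $\varphi\to\Diamond\varphi$, $\Box\varphi\to\Box\Box\varphi$, $\Diamond\Diamond\varphi\to\Diamond\varphi$, closed under modus ponens and necessitation. $\mathsf{S4I}$ is $\mathsf{CS4}$ extended with all instances of $\Diamond(\varphi\vee\psi)\to\Diamond\varphi\vee\Diamond\psi$, $\neg\Diamond\bot$, and $\Box(\varphi\vee\psi)\to\Box\varphi\vee\Diamond\psi$ (closed under the same rules). -}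

module Defs where

open import Level using (0ℓ)
open import Data.Fin using (Fin)
open import Data.Nat using (ℕ)
open import Data.Product using (_×_; ∃-syntax)
open import Data.Sum using (_⊎_)
open import Function.Bundles using (_↔_)
open import Relation.Binary.Core using (Rel)
open import Relation.Binary.Definitions using (_Respects_)
open import Relation.Binary.PropositionalEquality using (_≡_)
open import Relation.Binary.Structures using (IsPreorder)
open import Relation.Unary using (Pred; _∈_; _∉_; _⊆_; Empty; ∅)

infixr 7 _∧_
infixr 6 _∨_
infixr 5 _⇒_
infix  8 ◇_ □_ ~_

-- The countably infinite set of propositional variables is ℕ.
data Formula : Set where
  var         : ℕ → Formula
  ⊥'          : Formula
  _∧_ _∨_ _⇒_ : Formula → Formula → Formula
  ◇_ □_       : Formula → Formula

~_ : Formula → Formula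
~ φ = φ ⇒ ⊥'

-- Intuitionistic tautologies in the modal language, i.e. the substitution
-- instances of theorems of IPC, given by a standard Hilbert calculus whose
-- schemes range over all modal formulas.
data IPC : Pred Formula 0ℓ where
  K       : ∀ {φ ψ}   → IPC (φ ⇒ ψ ⇒ φ)
  S       : ∀ {φ ψ χ} → IPC ((φ ⇒ ψ ⇒ χ) ⇒ (φ ⇒ ψ) ⇒ φ ⇒ χ)
  ∧-intro : ∀ {φ ψ}   → IPC (φ ⇒ ψ ⇒ φ ∧ ψ)
  ∧-fst   : ∀ {φ ψ}   → IPC (φ ∧ ψ ⇒ φ)
  ∧-snd   : ∀ {φ ψ}   → IPC (φ ∧ ψ ⇒ ψ)
  ∨-inl   : ∀ {φ ψ}   → IPC (φ ⇒ φ ∨ ψ)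
  ∨-inr   : ∀ {φ ψ}   → IPC (ψ ⇒ φ ∨ ψ)
  ∨-elim  : ∀ {φ ψ χ} → IPC ((φ ⇒ χ) ⇒ (ψ ⇒ χ) ⇒ φ ∨ ψ ⇒ χ)
  efq     : ∀ {φ}     → IPC (⊥' ⇒ φ)
  mp      : ∀ {φ ψ}   → IPC (φ ⇒ ψ) → IPC φ → IPC ψ

-- CS4⊕ Ax is the extension of CS4 by the formulas in Ax.
data CS4⊕ (Ax : Pred Formula 0ℓ) : Pred Formula 0ℓ where
  taut  : ∀ {φ}   → φ ∈ IPC → CS4⊕ Ax φ
  K□    : ∀ {φ ψ} → CS4⊕ Ax (□ (φ ⇒ ψ) ⇒ (□ φ ⇒ □ ψ))
  K◇    : ∀ {φ ψ} → CS4⊕ Ax (□ (φ ⇒ ψ) ⇒ (◇ φ ⇒ ◇ ψ))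
  T□    : ∀ {φ}   → CS4⊕ Ax (□ φ ⇒ φ)
  T◇    : ∀ {φ}   → CS4⊕ Ax (φ ⇒ ◇ φ)
  4□    : ∀ {φ}   → CS4⊕ Ax (□ φ ⇒ □ □ φ)
  4◇    : ∀ {φ}   → CS4⊕ Ax (◇ ◇ φ ⇒ ◇ φ)
  axiom : ∀ {φ}   → φ ∈ Ax → CS4⊕ Ax φ
  mp    : ∀ {φ ψ} → CS4⊕ Ax (φ ⇒ ψ) → CS4⊕ Ax φ → CS4⊕ Ax ψ
  nec   : ∀ {φ}   → CS4⊕ Ax φ → CS4⊕ Ax (□ φ)

CS4 : Pred Formula 0ℓ
CS4 = CS4⊕ ∅

data S4IAxiom : Pred Formula 0ℓ where
  DP : ∀ {φ ψ} → S4IAxiom (◇ (φ ∨ ψ) ⇒ ◇ φ ∨ ◇ ψ)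
  N  : S4IAxiom (~ ◇ ⊥')
  CD : ∀ {φ ψ} → S4IAxiom (□ (φ ∨ ψ) ⇒ □ φ ∨ ◇ ψ)

S4I : Pred Formula 0ℓ
S4I = CS4⊕ S4IAxiom

record Frame : Set₁ where
  infix 4 _≼_ _⊑_
  field
    W            : Set
    W⊥           : Pred W 0ℓ
    _≼_          : Rel W 0ℓ
    _⊑_          : Rel W 0ℓ
    ≼-isPreorder : IsPreorder _≡_ _≼_
    ⊑-isPreorder : IsPreorder _≡_ _⊑_
    W⊥-≼-upward  : W⊥ Respects _≼_
    W⊥-⊑-upward  : W⊥ Respects _⊑_

  Infallible : Set
  Infallible = Empty W⊥

  ForwardConfluent : Set
  ForwardConfluent = ∀ {w w' v} → w ≼ w' → w ⊑ v → ∃[ v' ] (v ≼ v' × w' ⊑ v')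

  DownwardConfluent : Set
  DownwardConfluent = ∀ {w v v'} → w ≼ v → v ⊑ v' → ∃[ w' ] (w ⊑ w' × w' ≼ v')

record IsS4IFrame (F : Frame) : Set where
  open Frame F
  field
    infallible        : Infallible
    forwardConfluent  : ForwardConfluent
    downwardConfluent : DownwardConfluent

record Model : Set₁ where
  field
    frame : Frame
  open Frame frame public
  field
    V          : ℕ → Pred W 0ℓ
    V-≼-upward : ∀ p → V p Respects _≼_
    W⊥⊆V       : ∀ p → W⊥ ⊆ V p

IsS4IModel : Model → Set
IsS4IModel M = IsS4IFrame (Model.frame M)

module Satisfaction (M : Model) where
  open Model M

  infix 3 _⊩_

  _⊩_ : W → Formula → Set
  w ⊩ var p = w ∈ V p
  w ⊩ ⊥'    = w ∈ W⊥
  w ⊩ φ ∧ ψ = (w ⊩ φ) × (w ⊩ ψ)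
  w ⊩ φ ∨ ψ = (w ⊩ φ) ⊎ (w ⊩ ψ)
  w ⊩ φ ⇒ ψ = ∀ v → w ≼ v → v ⊩ φ → v ⊩ ψ
  w ⊩ ◇ φ   = ∀ u → w ≼ u → ∃[ v ] (u ⊑ v × (v ⊩ φ))
  w ⊩ □ φ   = ∀ u v → w ≼ u → u ⊑ v → v ⊩ φ

infix 3 _⊨_

_⊨_ : Model → Formula → Set
M ⊨ φ = ∀ w → w ∉ W⊥ → w ⊩ φ
  where
  open Model M
  open Satisfaction M

Finite : Set → Set
Finite A = ∃[ n ] (A ↔ Fin n)

{-# OPTIONS --safe #-}

-- A world of the finite model is a node of a finite tree whose nodes are labelled by sets of
-- subformulas of φ; ≼ is the tree order, and w ⊑ v holds when a monotone map of the whole tree of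
-- w into the tree of v, respecting asserted boxes and denied diamonds, sends w to v. Both
-- confluence conditions then hold outright. The trees t considered are those whose characteristic
-- formula χ t (saying that t is not realised above the present world) is unprovable. A modal
-- demand at a node of t is met by relabelling t with only its boxed and diamond formulas, adding
-- the demand, and completing: the axioms for ◇(∨), ¬◇⊥ and CD give □ χ t′ ≤ χ t for the
-- relabelled t′. Merging nodes with equal labels bounds the height, and forgetting repeated
-- siblings leaves finitely many trees.
--
-- Provability is not known to be decidable at this point. The set of worlds therefore consists of
-- the nodes of all trees of bounded height, the unprovability of χ t enters only through the relations, and the
-- finitely many existence statements needed for the truth lemma are obtained up to double
-- negation, which suffices for the negative conclusion.
module Submission where

open import Defs
open import Level using (0ℓ)
open import Data.Bool.Base using (Bool; true; false)
open import Data.Empty using (⊥; ⊥-elim)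
open import Data.Fin.Base using (Fin; zero; suc)
open import Data.Fin.Properties using (any?; sequence)
open import Data.Fin.Subset using (Subset; inside; outside; _∈_; _⊆_; _⊂_; _∩_; _∪_; ⁅_⁆; ∣_∣) renaming (⊥ to ∅ˢ)
open import Data.Fin.Subset.Properties using (_∈?_; x∈⁅x⁆; x∈⁅y⁆⇒x≡y; x∈p∩q⁺; x∈p∩q⁻; x∈p∪q⁻; p∩q⊆p; p⊆p∪q; q⊆p∪q; ⊆-antisym; ∉⊥; p⊂q⇒∣p∣<∣q∣; ∣p∣≤n)
open import Data.List.Base using (List; []; _∷_; _++_; map; filter; length; lookup; allFin; concatMap; cartesianProduct; cartesianProductWith)
open import Data.List.Membership.Propositional using () renaming (_∈_ to _∈ˡ_)
open import Data.List.Membership.Propositional.Properties using (∈-map⁺; ∈-map⁻; ∈-map∘filter⁻; ∈-map∘filter⁺; ∈-++⁺ˡ; ∈-++⁺ʳ; ∈-++⁻; ∈-allFin; ∈-lookup; ∈-concatMap⁺; ∈-concatMap⁻; ∈-cartesianProduct⁺; ∈-cartesianProductWith⁺)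
open import Data.List.Relation.Binary.Subset.Propositional using () renaming (_⊆_ to _⊆ˡ_)
open import Data.List.Relation.Binary.Subset.Propositional.Properties using (∷⁺ʳ)
open import Data.List.Relation.Unary.Any as Any using (here; there; index)
open import Data.List.Relation.Unary.Any.Properties using (lookup-index)
open import Data.Nat.Base using (ℕ; zero; suc; _∸_; s≤s; _≤′_; ≤′-refl; ≤′-step) renaming (_≤_ to _≤ᴺ_; _<_ to _<ᴺ_)
open import Data.Nat.Properties using (≤⇒≤′; ∸-monoʳ-<; m∸n≤m) renaming (≤-trans to ≤ᴺ-trans)
open import Data.Product using (_×_; Σ-syntax; ∃; ∃-syntax; _,_; proj₁; proj₂)
open import Data.Sum using (_⊎_; inj₁; inj₂)
open import Data.Vec.Base using ([]; _∷_; tabulate)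
open import Data.Vec.Properties using (lookup⇒[]=; []=⇒lookup; lookup∘tabulate)
open import Effect.Monad using (RawMonad)
open import Function.Base using (_∘_; id; case_of_)
open import Function.Construct.Identity using (↔-id)
open import Relation.Binary.Core using (Rel)
open import Relation.Binary.Definitions using (Trans; Reflexive; Transitive)
open import Relation.Binary.PropositionalEquality using (_≡_; refl; sym; trans; cong; subst; isEquivalence)
open import Relation.Nullary using (¬_; yes; no; contradiction)
open import Relation.Nullary.Decidable using (_×-dec_; ¬?; decidable-stable)
open import Relation.Nullary.Negation using (¬¬-Monad)
open import Relation.Unary using (Pred; _∉_)

private variable
  a b c d : Formula

-- The Lindenbaum algebra of S4I

infix 2 _≤_
infixr 1 _⨾_

_≤_ : Formula → Formula → Set
a ≤ b = S4I (a ⇒ b)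

⊤' : Formula
⊤' = ⊥' ⇒ ⊥'

const : S4I b → a ≤ b
const = mp (taut K)

_⨾_ : a ≤ b → b ≤ c → a ≤ c
f ⨾ g = mp (mp (taut S) (const g)) f

≤-refl : a ≤ a
≤-refl {a} = mp (mp (taut S) (taut K)) (taut (K {ψ = a}))

≤-reflexive : a ≡ b → a ≤ b
≤-reflexive refl = ≤-refl

apply : a ≤ b ⇒ c → a ≤ b → a ≤ c
apply f g = mp (mp (taut S) f) g

fst : a ∧ b ≤ a
fst = taut ∧-fst

snd : a ∧ b ≤ b
snd = taut ∧-snd

⟨_,_⟩ : a ≤ b → a ≤ c → a ≤ b ∧ c
⟨ f , g ⟩ = apply (f ⨾ taut ∧-intro) g

curry : a ∧ b ≤ c → a ≤ b ⇒ c
curry f = taut ∧-intro ⨾ mp (taut S) (const f)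

inl : a ≤ a ∨ b
inl = taut ∨-inl

inr : b ≤ a ∨ b
inr = taut ∨-inr

[_,_] : a ≤ c → b ≤ c → a ∨ b ≤ c
[ f , g ] = mp (mp (taut ∨-elim) f) g

⊥-min : ⊥' ≤ a
⊥-min = taut efq

⊢⊤ : S4I ⊤'
⊢⊤ = ≤-refl

case-in : c ∧ a ≤ d → c ∧ b ≤ d → c ≤ a ∨ b → c ≤ d
case-in f g h = apply (h ⨾ [ swap f , swap g ]) ≤-refl
  where
  swap : ∀ {x y z} → x ∧ y ≤ z → y ≤ x ⇒ z
  swap k = curry (⟨ snd , fst ⟩ ⨾ k)

∨-mono : a ≤ b → c ≤ d → a ∨ c ≤ b ∨ d
∨-mono f g = [ f ⨾ inl , g ⨾ inr ]

⇒-mono : b ≤ a → c ≤ d → a ⇒ c ≤ b ⇒ d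
⇒-mono f g = curry (apply fst (snd ⨾ f) ⨾ g)

□-mono : a ≤ b → □ a ≤ □ b
□-mono f = mp K□ (nec f)

◇-mono : a ≤ b → ◇ a ≤ ◇ b
◇-mono f = mp K◇ (nec f)

□-∧ : □ a ∧ □ b ≤ □ (a ∧ b)
□-∧ = apply (fst ⨾ □-mono (taut ∧-intro) ⨾ K□) snd

□-apply : c ≤ □ (a ⇒ b) → c ≤ □ a → c ≤ □ b
□-apply f g = apply (f ⨾ K□) g

⋀ ⋁ : List Formula → Formula
⋀ []       = ⊤'
⋀ (x ∷ xs) = x ∧ ⋀ xs
⋁ []       = ⊥'
⋁ (x ∷ xs) = x ∨ ⋁ xs

private variable
  xs : List Formula

⋀-lower : a ∈ˡ xs → ⋀ xs ≤ a
⋀-lower (here refl) = fst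
⋀-lower (there i)   = snd ⨾ ⋀-lower i

⋀-greatest : (∀ {x} → x ∈ˡ xs → a ≤ x) → a ≤ ⋀ xs
⋀-greatest {[]}     f = const ⊢⊤
⋀-greatest {x ∷ xs} f = ⟨ f (here refl) , ⋀-greatest (f ∘ there) ⟩

⋁-upper : a ∈ˡ xs → a ≤ ⋁ xs
⋁-upper (here refl) = inl
⋁-upper (there i)   = ⋁-upper i ⨾ inr

⋁-least : (∀ {x} → x ∈ˡ xs → x ≤ a) → ⋁ xs ≤ a
⋁-least {[]}     f = ⊥-min
⋁-least {x ∷ xs} f = [ f (here refl) , ⋁-least (f ∘ there) ]

□⋀-greatest : (∀ {x} → x ∈ˡ xs → a ≤ □ x) → a ≤ □ ⋀ xs
□⋀-greatest {[]}     f = const (nec ⊢⊤)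
□⋀-greatest {x ∷ xs} f = ⟨ f (here refl) , □⋀-greatest (f ∘ there) ⟩ ⨾ □-∧

◇⋁-least : (∀ {x} → x ∈ˡ xs → ◇ x ≤ a) → ◇ ⋁ xs ≤ a
◇⋁-least {[]}     f = axiom N ⨾ ⊥-min
◇⋁-least {x ∷ xs} f = axiom DP ⨾ [ f (here refl) , ◇⋁-least (f ∘ there) ]

-- Completion runs relative to a filter instead of provability: a subtree is completed inside the
-- formula of a larger tree, and the filters derived below express that surrounding formula.
record Filter : Set₁ where
  field
    Mem  : Pred Formula 0ℓ
    up   : a ≤ b → Mem a → Mem b
    top  : Mem ⊤'
    meet : Mem a → Mem b → Mem (a ∧ b)

  theorem : S4I a → Mem a
  theorem p = up (const p) top

open Filter

residual : Formula → Filter → Filter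
residual c F = record
  { Mem  = λ x → Mem F (c ⇒ x)
  ; up   = λ f → up F (⇒-mono ≤-refl f)
  ; top  = theorem F (const ⊢⊤)
  ; meet = λ p q → up F (curry ⟨ apply (fst ⨾ fst) snd , apply (fst ⨾ snd) snd ⟩) (meet F p q)
  }

joinˡ : Formula → Filter → Filter
joinˡ c F = record
  { Mem  = λ x → Mem F (c ∨ x)
  ; up   = λ f → up F (∨-mono ≤-refl f)
  ; top  = theorem F (mp inr ⊢⊤)
  ; meet = λ p q → up F
      (case-in (snd ⨾ inl) (case-in (snd ⨾ inl) (⟨ fst ⨾ snd , snd ⟩ ⨾ inr) (fst ⨾ snd)) fst)
      (meet F p q)
  }

joinʳ : Formula → Filter → Filter
joinʳ c F = record
  { Mem  = λ x → Mem F (x ∨ c)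
  ; up   = λ f → up F (∨-mono f ≤-refl)
  ; top  = theorem F (mp inl ⊢⊤)
  ; meet = λ p q → up F ([ inr , inl ]) (meet (joinˡ c F) (up F [ inr , inl ] p) (up F [ inr , inl ] q))
  }

-- Running completion in this filter refutes the absence of a suitable completion without deciding
-- provability.
notRefutable : Filter
notRefutable = record
  { Mem  = λ x → ¬ ¬ S4I x
  ; up   = λ f p k → p (k ∘ mp f)
  ; top  = λ k → k ⊢⊤
  ; meet = λ p q k → p λ s → q λ t → k (mp (mp (taut ∧-intro) s) t)
  }

-- Finite lists and subsets

-- Every list of members of xs is, up to order and repetition, one of these.
sublists : {A : Set} → List A → List (List A)
sublists []       = [] ∷ []
sublists (x ∷ xs) = sublists xs ++ map (x ∷_) (sublists xs)

swap-⊆ˡ : ∀ {A : Set} {x y : A} {xs} → x ∷ y ∷ xs ⊆ˡ y ∷ x ∷ xs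
swap-⊆ˡ (here e)          = there (here e)
swap-⊆ˡ (there (here e))  = here e
swap-⊆ˡ (there (there i)) = there (there i)

contract-⊆ˡ : ∀ {A : Set} {x : A} {xs} → x ∷ x ∷ xs ⊆ˡ x ∷ xs
contract-⊆ˡ (here e)  = here e
contract-⊆ˡ (there i) = i

insert-sublists : ∀ {A : Set} {x : A} {xs} ys → x ∈ˡ ys → xs ∈ˡ sublists ys →
                  ∃[ zs ] (zs ∈ˡ sublists ys × x ∷ xs ⊆ˡ zs × zs ⊆ˡ x ∷ xs)
insert-sublists (y ∷ ys) x∈ s with ∈-++⁻ (sublists ys) s
insert-sublists (y ∷ ys) (here refl) s | inj₁ t =
  _ , ∈-++⁺ʳ (sublists ys) (∈-map⁺ (y ∷_) t) , id , id
insert-sublists (y ∷ ys) (here refl) s | inj₂ t with ∈-map⁻ (y ∷_) t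
... | _ , _ , refl = _ , s , contract-⊆ˡ , there
insert-sublists (y ∷ ys) (there x∈) s | inj₁ t with insert-sublists ys x∈ t
... | zs , u , f , g = zs , ∈-++⁺ˡ u , f , g
insert-sublists (y ∷ ys) (there x∈) s | inj₂ t with ∈-map⁻ (y ∷_) t
... | _ , t′ , refl with insert-sublists ys x∈ t′
... | zs , u , f , g = y ∷ zs , ∈-++⁺ʳ (sublists ys) (∈-map⁺ (y ∷_) u) ,
  ∷⁺ʳ y f ∘ swap-⊆ˡ , swap-⊆ˡ ∘ ∷⁺ʳ y g

[]∈sublists : ∀ {A : Set} (ys : List A) → [] ∈ˡ sublists ys
[]∈sublists []       = here refl
[]∈sublists (y ∷ ys) = ∈-++⁺ˡ ([]∈sublists ys)

canonical-sublist : ∀ {A : Set} {xs ys : List A} → xs ⊆ˡ ys →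
                    ∃[ zs ] (zs ∈ˡ sublists ys × xs ⊆ˡ zs × zs ⊆ˡ xs)
canonical-sublist {xs = []} {ys} f = [] , []∈sublists ys , id , id
canonical-sublist {xs = x ∷ xs} {ys} f with canonical-sublist (f ∘ there)
... | zs , s , g , h with insert-sublists ys (f (here refl)) s
... | ws , t , g′ , h′ = ws , t , g′ ∘ ∷⁺ʳ x g , ∷⁺ʳ x h ∘ h′

allSubsets : ∀ n → List (Subset n)
allSubsets zero    = [] ∷ []
allSubsets (suc n) = cartesianProductWith _∷_ (inside ∷ outside ∷ []) (allSubsets n)

∈-allSubsets : ∀ {n} (p : Subset n) → p ∈ˡ allSubsets n
∈-allSubsets []      = here refl
∈-allSubsets (s ∷ p) = ∈-cartesianProductWith⁺ _∷_ (∈-sides s) (∈-allSubsets p)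
  where
  ∈-sides : ∀ s → s ∈ˡ inside ∷ outside ∷ []
  ∈-sides true  = here refl
  ∈-sides false = there (here refl)

⊆-or-∃ : ∀ {n} (p q : Subset n) → p ⊆ q ⊎ ∃[ i ] (i ∈ p × ¬ i ∈ q)
⊆-or-∃ p q with any? (λ i → i ∈? p ×-dec ¬? (i ∈? q))
... | yes w = inj₂ w
... | no ¬w = inj₁ (λ {i} i∈p → decidable-stable (i ∈? q) (λ i∉q → ¬w (i , i∈p , i∉q)))

-- Double-negation shift, valid because the index set is finite.
¬¬-∀Fin : ∀ {n} {P : Fin n → Set} → (∀ i → ¬ ¬ P i) → ¬ ¬ (∀ i → P i)
¬¬-∀Fin = sequence (RawMonad.rawApplicative ¬¬-Monad)

isBox isDia : Formula → Bool
isBox (□ _) = true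
isBox _     = false
isDia (◇ _) = true
isDia _     = false

box-shape : ∀ a → isBox a ≡ true → ∃[ b ] a ≡ □ b
box-shape (□ b) refl = b , refl

dia-shape : ∀ a → isDia a ≡ true → ∃[ b ] a ≡ ◇ b
dia-shape (◇ b) refl = b , refl

imp-shape : ∀ a → (∃[ b ] ∃[ c ] a ≡ (b ⇒ c)) ⊎ (∀ {b c} → ¬ a ≡ (b ⇒ c))
imp-shape (var _) = inj₂ λ ()
imp-shape ⊥'      = inj₂ λ ()
imp-shape (_ ∧ _) = inj₂ λ ()
imp-shape (_ ∨ _) = inj₂ λ ()
imp-shape (b ⇒ c) = inj₁ (b , c , refl)
imp-shape (◇ _)   = inj₂ λ ()
imp-shape (□ _)   = inj₂ λ ()

-- Labelled trees and simulations

-- A label (P , Q) asserts the formulas of P and denies those of Q.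
Label : ℕ → Set
Label n = Subset n × Subset n

data Tree (n : ℕ) : Set where
  node : Label n → List (Tree n) → Tree n

module _ {n : ℕ} where

  label : Tree n → Label n
  label (node l _) = l

  pos neg : Tree n → Subset n
  pos t = proj₁ (label t)
  neg t = proj₂ (label t)

  kids : Tree n → List (Tree n)
  kids (node _ ts) = ts

  infixr 5 _∙_

  data Path : Tree n → Tree n → Set where
    stay : ∀ {t} → Path t t
    down : ∀ {t s u} → s ∈ˡ kids t → Path s u → Path t u

  _∙_ : ∀ {t u v} → Path t u → Path u v → Path t v
  stay     ∙ q = q
  down i p ∙ q = down i (p ∙ q)

  ∙-identityʳ : ∀ {t u} (p : Path t u) → p ∙ stay ≡ p
  ∙-identityʳ stay       = refl
  ∙-identityʳ (down i p) = cong (down i) (∙-identityʳ p)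

  ∙-assoc : ∀ {t u v w} (p : Path t u) (q : Path u v) (r : Path v w) → (p ∙ q) ∙ r ≡ p ∙ q ∙ r
  ∙-assoc stay       q r = refl
  ∙-assoc (down i p) q r = cong (down i) (∙-assoc p q r)

  paths : (t : Tree n) → List (∃ (Path t))
  pathsᶠ : (ts : List (Tree n)) → List (∃[ s ] ∃[ u ] (s ∈ˡ ts × Path s u))
  paths (node l ts) = (_ , stay) ∷ map (λ (s , u , i , p) → u , down i p) (pathsᶠ ts)
  pathsᶠ []       = []
  pathsᶠ (t ∷ ts) = map (λ (u , p) → t , u , here refl , p) (paths t)
                    ++ map (λ (s , u , i , p) → s , u , there i , p) (pathsᶠ ts)

  ∈-paths : ∀ {t u} (p : Path t u) → (u , p) ∈ˡ paths t
  ∈-pathsᶠ : ∀ {ts s u} (i : s ∈ˡ ts) (p : Path s u) → (s , u , i , p) ∈ˡ pathsᶠ ts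
  ∈-paths {node l ts} stay       = here refl
  ∈-paths {node l ts} (down i p) = there (∈-map⁺ _ (∈-pathsᶠ i p))
  ∈-pathsᶠ {t ∷ ts} (here refl) p = ∈-++⁺ˡ (∈-map⁺ _ (∈-paths p))
  ∈-pathsᶠ {t ∷ ts} (there i)   p = ∈-++⁺ʳ _ (∈-map⁺ _ (∈-pathsᶠ i p))

  -- A monotone map given node by node. A child may go to any descendant of the image of its parent,
  -- or to that image itself, so edges may be collapsed.
  data Sim (R : Rel (Label n) 0ℓ) : Rel (Tree n) 0ℓ where
    sim : ∀ {l ts t} → R l (label t) →
          (∀ {s} → s ∈ˡ ts → ∃[ u ] (Path t u × Sim R s u)) → Sim R (node l ts) t

  -- The trees on the first path are simulated, in order, by trees on the second, the last by the last.
  data Match (R : Rel (Label n) 0ℓ) : ∀ {s t u v} → Path s u → Path t v → Set where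
    stop : ∀ {s t} → Sim R s t → Match R (stay {s}) (stay {t})
    both : ∀ {s s′ t u v} {i : s′ ∈ˡ kids s} {p : Path s′ u} {q : Path t v} →
           Sim R s t → Match R p q → Match R (down {s} i p) q
    skip : ∀ {s t t′ u v} {j : t′ ∈ˡ kids t} {p : Path s u} {q : Path t′ v} →
           Match R p q → Match R p (down {t} j q)

  module _ {R : Rel (Label n) 0ℓ} where

    Sim-label : ∀ {s t} → Sim R s t → R (label s) (label t)
    Sim-label (sim r _) = r

    Sim-refl : Reflexive R → ∀ t → Sim R t t
    Sim-reflᶠ : Reflexive R → ∀ ts {s} → s ∈ˡ ts → Sim R s s
    Sim-refl ρ (node l ts) = sim ρ (λ i → _ , down i stay , Sim-reflᶠ ρ ts i)
    Sim-reflᶠ ρ (t ∷ ts) (here refl) = Sim-refl ρ t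
    Sim-reflᶠ ρ (t ∷ ts) (there i)   = Sim-reflᶠ ρ ts i

    Sim-path : ∀ {s t u} → Sim R s t → Path s u → ∃[ v ] (Path t v × Sim R u v)
    Sim-path σ stay = _ , stay , σ
    Sim-path (sim _ f) (down i p) with f i
    ... | _ , q , τ with Sim-path τ p
    ... | _ , r , υ = _ , q ∙ r , υ

    skips : ∀ {s t t′ u v} {p : Path s u} {q : Path t′ v} (r : Path t t′) →
            Match R p q → Match R p (r ∙ q)
    skips stay       m = m
    skips (down j r) m = skip (skips r m)

    Match-tip : ∀ {s t u v} {p : Path s u} {q : Path t v} → Match R p q → R (label u) (label v)
    Match-tip (stop σ)   = Sim-label σ
    Match-tip (both _ m) = Match-tip m
    Match-tip (skip m)   = Match-tip m

    Match-refl : Reflexive R → ∀ {t u} (p : Path t u) → Match R p p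
    Match-refl ρ stay       = stop (Sim-refl ρ _)
    Match-refl ρ (down i p) = both (Sim-refl ρ _) (skip (Match-refl ρ p))

    Match-lift : ∀ {s t u} → Sim R s t → (p : Path s u) → ∃[ v ] Σ[ q ∈ Path t v ] Match R p q
    Match-lift σ stay = _ , stay , stop σ
    Match-lift σ@(sim _ f) (down i p) with f i
    ... | _ , r , τ with Match-lift τ p
    ... | _ , q , m = _ , r ∙ q , both σ (skips r m)

    -- A matching ends in a simulation of the whole subtree at the tip, and the extension is
    -- transported along it. This yields forward confluence.
    Match-extend : ∀ {s t u v w} {p : Path s u} {q : Path t v} → Match R p q → (r : Path u w) →
                   ∃[ x ] Σ[ r′ ∈ Path v x ] Match R (p ∙ r) (q ∙ r′)
    Match-extend (stop σ)   r = Match-lift σ r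
    Match-extend (both σ m) r with Match-extend m r
    ... | _ , r′ , m′ = _ , r′ , both σ m′
    Match-extend (skip m)   r with Match-extend m r
    ... | _ , r′ , m′ = _ , r′ , skip m′

    -- The second path is cut at the image of the tip of `p`; the simulation stored there ends the
    -- shorter matching. This yields downward confluence.
    Match-prefix : ∀ {s t u v w} (p : Path s u) {r : Path u w} {q : Path t v} → Match R (p ∙ r) q →
                   ∃[ x ] Σ[ q₁ ∈ Path t x ] Σ[ q₂ ∈ Path x v ] (q ≡ q₁ ∙ q₂ × Match R p q₁)
    Match-prefix stay       (stop σ)   = _ , stay , _ , refl , stop σ
    Match-prefix stay       (both σ _) = _ , stay , _ , refl , stop σ
    Match-prefix (down i p) (both σ m) with Match-prefix p m
    ... | _ , q₁ , q₂ , refl , m′ = _ , q₁ , q₂ , refl , both σ m′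
    Match-prefix p          (skip m)   with Match-prefix p m
    ... | _ , q₁ , q₂ , refl , m′ = _ , down _ q₁ , q₂ , refl , skip m′

  module _ {R S T : Rel (Label n) 0ℓ} (τ : Trans R S T) where

    -- Three relations are allowed because completion follows a modal step: `Mod` followed by `Ext`
    -- is again `Mod`.
    Sim-trans : Trans (Sim R) (Sim S) (Sim T)
    Sim-trans (sim r f) σ = sim (τ r (Sim-label σ)) λ i →
      let _ , p , ρ = f i
          _ , q , υ = Sim-path σ p
      in _ , q , Sim-trans ρ υ

    Match-trans : ∀ {s t u v w x} {p : Path s u} {q : Path t v} {r : Path w x} →
                  Match R p q → Match S q r → Match T p r
    Match-trans m          (skip m′)   = skip (Match-trans m m′)
    Match-trans (stop σ)   (stop σ′)   = stop (Sim-trans σ σ′)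
    Match-trans (both σ m) (stop σ′)   = both (Sim-trans σ σ′) (Match-trans m (stop σ′))
    Match-trans (both σ m) (both σ′ m′) = both (Sim-trans σ σ′) (Match-trans m (both σ′ m′))
    Match-trans (skip m)   (both σ′ m′) = Match-trans m m′

  -- All trees of height at most m, up to order and repetition of siblings.
  universe : ℕ → List (Tree n)
  universe zero    = []
  universe (suc m) = universe m ++ cartesianProductWith node
    (cartesianProduct (allSubsets n) (allSubsets n)) (sublists (universe m))

  node∈universe : ∀ m {l ts} → ts ∈ˡ sublists (universe m) → node l ts ∈ˡ universe (suc m)
  node∈universe m i = ∈-++⁺ʳ (universe m) (∈-cartesianProductWith⁺ node
    (∈-cartesianProduct⁺ (∈-allSubsets _) (∈-allSubsets _)) i)

  universe-mono : ∀ {m k} → m ≤′ k → universe m ⊆ˡ universe k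
  universe-mono ≤′-refl       = id
  universe-mono (≤′-step m≤k) = ∈-++⁺ˡ ∘ universe-mono m≤k

-- Labels and characteristic formulas

record SubformulaClosed {n : ℕ} (at : Fin n → Formula) : Set where
  field
    ∧-closed : ∀ {i} → at i ≡ (a ∧ b) → (∃[ j ] at j ≡ a) × (∃[ k ] at k ≡ b)
    ∨-closed : ∀ {i} → at i ≡ (a ∨ b) → (∃[ j ] at j ≡ a) × (∃[ k ] at k ≡ b)
    ⇒-closed : ∀ {i} → at i ≡ (a ⇒ b) → (∃[ j ] at j ≡ a) × (∃[ k ] at k ≡ b)
    ◇-closed : ∀ {i} → at i ≡ (◇ a) → ∃[ j ] at j ≡ a
    □-closed : ∀ {i} → at i ≡ (□ a) → ∃[ j ] at j ≡ a

module Construction {n : ℕ} (at : Fin n → Formula) (closed : SubformulaClosed at) where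

  open SubformulaClosed closed

  private variable
    i j k : Fin n
    P Q P′ Q′ : Subset n
    l l′ : Label n
    s t u v : Tree n
    ts es : List (Tree n)

  members : Subset n → List Formula
  members P = map at (filter (_∈? P) (allFin n))

  ∈-members⁺ : i ∈ P → at i ∈ˡ members P
  ∈-members⁺ {i} {P} i∈P = ∈-map∘filter⁺ at (_∈? P) (i , ∈-allFin i , refl , i∈P)

  ∈-members⁻ : {B : Formula → Set} → (∀ {i} → i ∈ P → B (at i)) → a ∈ˡ members P → B a
  ∈-members⁻ {P} f a∈ with ∈-map∘filter⁻ at (_∈? P) {xs = allFin n} a∈
  ... | _ , _ , refl , i∈P = f i∈P

  Con Dis : Subset n → Formula
  Con P = ⋀ (members P)
  Dis Q = ⋁ (members Q)

  Con-lower : i ∈ P → Con P ≤ at i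
  Con-lower i∈P = ⋀-lower (∈-members⁺ i∈P)

  Con-greatest : (∀ {i} → i ∈ P → a ≤ at i) → a ≤ Con P
  Con-greatest {a = a} f = ⋀-greatest (∈-members⁻ {B = a ≤_} f)

  □Con-greatest : (∀ {i} → i ∈ P → a ≤ □ at i) → a ≤ □ Con P
  □Con-greatest {a = a} f = □⋀-greatest (∈-members⁻ {B = λ x → a ≤ □ x} f)

  Dis-upper : i ∈ Q → at i ≤ Dis Q
  Dis-upper i∈Q = ⋁-upper (∈-members⁺ i∈Q)

  Dis-least : (∀ {i} → i ∈ Q → at i ≤ a) → Dis Q ≤ a
  Dis-least {a = a} f = ⋁-least (∈-members⁻ {B = _≤ a} f)

  ◇Dis-least : (∀ {i} → i ∈ Q → ◇ at i ≤ a) → ◇ Dis Q ≤ a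
  ◇Dis-least {a = a} f = ◇⋁-least (∈-members⁻ {B = λ x → ◇ x ≤ a} f)

  Con-∪ : ∀ P P′ → Con P ∧ Con P′ ≤ Con (P ∪ P′)
  Con-∪ P P′ = Con-greatest λ i∈ → case x∈p∪q⁻ P P′ i∈ of λ where
    (inj₁ i∈P) → fst ⨾ Con-lower i∈P
    (inj₂ i∈P′) → snd ⨾ Con-lower i∈P′

  Dis-∪ : ∀ Q Q′ → Dis (Q ∪ Q′) ≤ Dis Q ∨ Dis Q′
  Dis-∪ Q Q′ = Dis-least λ i∈ → case x∈p∪q⁻ Q Q′ i∈ of λ where
    (inj₁ i∈Q) → Dis-upper i∈Q ⨾ inl
    (inj₂ i∈Q′) → Dis-upper i∈Q′ ⨾ inr

  Con-⁅⁆ : at i ≤ Con ⁅ i ⁆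
  Con-⁅⁆ {i} = Con-greatest λ j∈ → ≤-reflexive (cong at (sym (x∈⁅y⁆⇒x≡y i j∈)))

  Dis-⁅⁆ : Dis ⁅ i ⁆ ≤ at i
  Dis-⁅⁆ {i} = Dis-least λ j∈ → ≤-reflexive (cong at (x∈⁅y⁆⇒x≡y i j∈))

  Con-∅ : S4I (Con ∅ˢ)
  Con-∅ = mp (Con-greatest {a = ⊤'} (λ i∈ → contradiction i∈ ∉⊥)) ⊢⊤

  Dis-∅ : Dis ∅ˢ ≤ a
  Dis-∅ = Dis-least (λ i∈ → contradiction i∈ ∉⊥)

  -- A world refutes χ t iff t can be mapped monotonically into the worlds above it so that the
  -- image of each node satisfies what its label asserts and refutes what its label denies.
  χ : Tree n → Formula
  χs : List (Tree n) → Formula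
  χ (node (P , Q) ts) = Con P ⇒ (Dis Q ∨ χs ts)
  χs []       = ⊥'
  χs (t ∷ ts) = χ t ∨ χs ts

  χs-upper : t ∈ˡ ts → χ t ≤ χs ts
  χs-upper (here refl) = inl
  χs-upper (there i)   = χs-upper i ⨾ inr

  χs-mono : ts ⊆ˡ es → χs ts ≤ χs es
  χs-mono {[]}     f = ⊥-min
  χs-mono {t ∷ ts} f = [ χs-upper (f (here refl)) , χs-mono (f ∘ there) ]

  χ-mono : χs ts ≤ χs es → χ (node l ts) ≤ χ (node l es)
  χ-mono f = ⇒-mono ≤-refl (∨-mono ≤-refl f)

  χ-clash : i ∈ pos t → i ∈ neg t → S4I (χ t)
  χ-clash {t = node _ _} i∈P i∈Q = Con-lower i∈P ⨾ Dis-upper i∈Q ⨾ inl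

  χ-path : Path t u → χ u ≤ χ t
  χ-path stay = ≤-refl
  χ-path {node _ _} (down i p) = χ-path p ⨾ χs-upper i ⨾ inr ⨾ taut K

  -- Modal steps

  boxes dias : Subset n
  boxes = tabulate (isBox ∘ at)
  dias  = tabulate (isDia ∘ at)

  ∈-tabulate⁺ : ∀ {f} → f i ≡ true → i ∈ tabulate f
  ∈-tabulate⁺ {i} {f} e = lookup⇒[]= i (tabulate f) (trans (lookup∘tabulate f i) e)

  ∈-tabulate⁻ : ∀ {f} → i ∈ tabulate f → f i ≡ true
  ∈-tabulate⁻ {i} {f} i∈ = trans (sym (lookup∘tabulate f i)) ([]=⇒lookup i∈)

  -- `Ext` is what completion does to a label. `Mod` is what a modal step preserves, since `4□` and
  -- `4◇` carry asserted boxes and denied diamonds along it.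
  Ext Mod : Rel (Label n) 0ℓ
  Ext (P , Q) (P′ , Q′) = P ⊆ P′ × Q ⊆ Q′
  Mod (P , Q) (P′ , Q′) = P ∩ boxes ⊆ P′ × Q ∩ dias ⊆ Q′

  Ext-refl : Reflexive Ext
  Ext-refl = id , id

  Ext-trans : Trans Ext Ext Ext
  Ext-trans (f , g) (f′ , g′) = f′ ∘ f , g′ ∘ g

  Mod-refl : Reflexive Mod
  Mod-refl {P , Q} = p∩q⊆p P boxes , p∩q⊆p Q dias

  Mod-Ext-trans : Trans Mod Ext Mod
  Mod-Ext-trans (f , g) (f′ , g′) = f′ ∘ f , g′ ∘ g

  Mod-trans : Trans Mod Mod Mod
  Mod-trans {P , Q} (f , g) (f′ , g′) =
    (λ i∈ → f′ (x∈p∩q⁺ (f i∈ , proj₂ (x∈p∩q⁻ P boxes i∈)))) ,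
    (λ i∈ → g′ (x∈p∩q⁺ (g i∈ , proj₂ (x∈p∩q⁻ Q dias i∈))))

  modalPart : Label n → Label n
  modalPart (P , Q) = P ∩ boxes , Q ∩ dias

  _⊔_ : Label n → Label n → Label n
  (P , Q) ⊔ (P′ , Q′) = P ∪ P′ , Q ∪ Q′

  core : Tree n → Tree n
  cores : List (Tree n) → List (Tree n)
  core (node l ts) = node (modalPart l) (cores ts)
  cores []       = []
  cores (t ∷ ts) = core t ∷ cores ts

  -- The modal core of t with x added to the label at the tip of the path. The branch along the
  -- path is duplicated, so that the forest below each node can be left as it is.
  mark : Path t u → Label n → Tree n
  mark {t} stay       x = node (modalPart (label t) ⊔ x) (cores (kids t))
  mark {t} (down i p) x = node (modalPart (label t)) (mark p x ∷ cores (kids t))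

  core-sim : ∀ t → Sim Mod t (core t)
  cores-sim : t ∈ˡ ts → ∃[ s ] (s ∈ˡ cores ts × Sim Mod t s)
  core-sim (node l ts) = sim (id , id) λ i → let _ , j , σ = cores-sim i in _ , down j stay , σ
  cores-sim {ts = t ∷ ts} (here refl) = _ , here refl , core-sim t
  cores-sim {ts = t ∷ ts} (there i)   = let _ , j , σ = cores-sim i in _ , there j , σ

  mark-sim : (p : Path t u) (x : Label n) → Sim Mod t (mark p x)
  mark-sim {node (P , Q) ts} stay (P′ , Q′) = sim (p⊆p∪q P′ , p⊆p∪q Q′) λ i →
    let _ , j , σ = cores-sim i in _ , down j stay , σ
  mark-sim {node l ts} (down i p) x = sim (id , id) λ i →
    let _ , j , σ = cores-sim i in _ , down (there j) stay , σ

  markPath : (p : Path t u) (x : Label n) → Path (mark p x) (mark (stay {t = u}) x)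
  markPath stay       x = stay
  markPath (down i p) x = down (here refl) (markPath p x)

  mark-match : (p : Path t u) (x : Label n) → Match Mod p (markPath p x)
  mark-match stay       x = stop (mark-sim stay x)
  mark-match (down i p) x = both (mark-sim (down i p) x) (skip (mark-match p x))

  Con≤□Con : Con P ≤ □ Con (P ∩ boxes)
  Con≤□Con {P} = □Con-greatest λ {i} i∈ →
    let i∈P , i∈B = x∈p∩q⁻ P boxes i∈
        b , e     = box-shape (at i) (∈-tabulate⁻ i∈B)
    in Con-lower i∈P ⨾ subst (λ x → x ≤ □ x) (sym e) 4□

  ◇Dis≤Dis : ◇ Dis (Q ∩ dias) ≤ Dis Q
  ◇Dis≤Dis {Q} = ◇Dis-least λ {i} i∈ →
    let i∈Q , i∈D = x∈p∩q⁻ Q dias i∈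
        b , e     = dia-shape (at i) (∈-tabulate⁻ i∈D)
    in subst (λ x → ◇ x ≤ x) (sym e) 4◇ ⨾ Dis-upper i∈Q

  -- Under `Con P` the asserted boxes are boxed again by `4□`, so `K◇` moves the diamond onto the
  -- conclusion of the core. There `DP` splits it, `4◇` absorbs it on denied diamonds, and `N`
  -- removes the empty disjunction.
  ◇χ-core : ∀ t → ◇ χ (core t) ≤ χ t
  ◇χs-cores : ∀ Q ts → ◇ (Dis (Q ∩ dias) ∨ χs (cores ts)) ≤ Dis Q ∨ χs ts
  ◇χ-core (node (P , Q) ts) = curry
    (apply (snd ⨾ Con≤□Con ⨾ □-mono (curry (apply snd fst)) ⨾ K◇) fst ⨾ ◇χs-cores Q ts)
  ◇χs-cores Q []       = axiom DP ⨾ [ ◇Dis≤Dis ⨾ inl , axiom N ⨾ ⊥-min ]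
  ◇χs-cores Q (t ∷ ts) = ◇-mono [ inl ⨾ inr , [ inl , inr ⨾ inr ] ] ⨾ axiom DP ⨾
    [ ◇χ-core t ⨾ inl ⨾ inr , ◇χs-cores Q ts ⨾ ∨-mono ≤-refl inr ]

  -- A syntactic form of: above every world realising the first label, some modal successor
  -- realises the second label and the modal part of the first.
  Admissible : Label n → Label n → Set
  Admissible (P , Q) (P′ , Q′) = ∀ c →
    Con P ∧ □ (Con ((P ∩ boxes) ∪ P′) ⇒ (Dis ((Q ∩ dias) ∪ Q′) ∨ c)) ≤ Dis Q ∨ ◇ (Dis (Q ∩ dias) ∨ c)

  -- `CD` leaves the new denial `at j` under the box, where it becomes the denied `at i`, and puts
  -- the rest under the diamond.
  □-admissible : at i ≡ (□ at j) → i ∈ Q → Admissible (P , Q) (∅ˢ , ⁅ j ⁆)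
  □-admissible {j = j} {Q = Q} {P = P} e i∈Q c =
    □-apply (snd ⨾ □-mono (curry (apply fst (snd ⨾ Γ) ⨾ Δ))) (fst ⨾ Con≤□Con) ⨾ axiom CD ⨾
    ∨-mono (subst (_≤ Dis Q) e (Dis-upper i∈Q)) ≤-refl
    where
    Γ : Con (P ∩ boxes) ≤ Con ((P ∩ boxes) ∪ ∅ˢ)
    Γ = ⟨ ≤-refl , const Con-∅ ⟩ ⨾ Con-∪ (P ∩ boxes) ∅ˢ
    Δ : Dis ((Q ∩ dias) ∪ ⁅ j ⁆) ∨ c ≤ at j ∨ (Dis (Q ∩ dias) ∨ c)
    Δ = [ Dis-∪ (Q ∩ dias) ⁅ j ⁆ ⨾ [ inl ⨾ inr , Dis-⁅⁆ ⨾ inl ] , inr ⨾ inr ]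

  -- `K◇` applies the boxed implication to the asserted diamond, so everything lands in the right
  -- disjunct.
  ◇-admissible : at i ≡ (◇ at j) → i ∈ P → Admissible (P , Q) (⁅ j ⁆ , ∅ˢ)
  ◇-admissible {j = j} {P = P} {Q = Q} e i∈P c =
    apply (□-apply (snd ⨾ □-mono step) (fst ⨾ Con≤□Con) ⨾ K◇)
          (fst ⨾ subst (Con P ≤_) e (Con-lower i∈P)) ⨾ inr
    where
    Γ : Con (P ∩ boxes) ∧ at j ≤ Con ((P ∩ boxes) ∪ ⁅ j ⁆)
    Γ = ⟨ fst , snd ⨾ Con-⁅⁆ ⟩ ⨾ Con-∪ (P ∩ boxes) ⁅ j ⁆
    Δ : Dis ((Q ∩ dias) ∪ ∅ˢ) ∨ c ≤ Dis (Q ∩ dias) ∨ c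
    Δ = ∨-mono (Dis-∪ (Q ∩ dias) ∅ˢ ⨾ [ ≤-refl , Dis-∅ ]) ≤-refl
    step : Con ((P ∩ boxes) ∪ ⁅ j ⁆) ⇒ (Dis ((Q ∩ dias) ∪ ∅ˢ) ∨ c) ≤
           Con (P ∩ boxes) ⇒ (at j ⇒ (Dis (Q ∩ dias) ∨ c))
    step = curry (curry (apply (fst ⨾ fst) (⟨ fst ⨾ snd , snd ⟩ ⨾ Γ) ⨾ Δ))

  -- The axiom CD sends the marked branch under □ and all other branches under ◇.
  □χ-mark : ∀ {x} (p : Path t u) → Admissible (label u) x → □ χ (mark p x) ≤ χ t
  □χ-mark {node (P , Q) ts} {x = P′ , Q′} stay adm =
    curry (⟨ snd , fst ⟩ ⨾ adm _ ⨾ [ inl , ◇χs-cores Q ts ])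
  □χ-mark {node (P , Q) ts} (down i p) adm =
    curry (□-apply (fst ⨾ □-mono (⇒-mono ≤-refl [ inl ⨾ inr , [ inl , inr ⨾ inr ] ])) (snd ⨾ Con≤□Con) ⨾
      axiom CD ⨾ [ □χ-mark p adm ⨾ χs-upper i ⨾ inr , ◇χs-cores Q ts ])

  -- Completion of trees

  Complete : Label n → Set
  Complete (P , Q) = ∀ i → i ∈ P ⊎ i ∈ Q

  -- Indices are existential because `at` need not be injective.
  Witness : Formula → Formula → Label n → Set
  Witness b c (P , Q) = ∃[ j ] ∃[ k ] (at j ≡ b × at k ≡ c × j ∈ P × k ∈ Q)

  Witness-Ext : Ext l l′ → Witness b c l → Witness b c l′
  Witness-Ext (f , g) (j , k , e , e′ , j∈ , k∈) = j , k , e , e′ , f j∈ , g k∈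

  imp-witness : a ≡ (at j ⇒ at k) → a ≡ (b ⇒ c) → j ∈ P → k ∈ Q → Witness b c (P , Q)
  imp-witness refl refl j∈P k∈Q = _ , _ , refl , refl , j∈P , k∈Q

  Honest : Tree n → Set
  Honest t = ∀ {i b c} → at i ≡ (b ⇒ c) → i ∈ neg t → ∃[ u ] (Path t u × Witness b c (label u))

  -- Strict growth of the asserted sets bounds the height; taking the children literally from the
  -- enumerated lists leaves finitely many such trees.
  data Nice : Tree n → Set where
    nice : Complete (P , Q) → Honest (node (P , Q) ts) → ts ∈ˡ sublists (universe (n ∸ ∣ P ∣)) →
           (∀ {s} → s ∈ˡ ts → P ⊂ pos s) → (∀ {s} → s ∈ˡ ts → Nice s) → Nice (node (P , Q) ts)

  AllNice : List (Tree n) → Set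
  AllNice ts = ∀ {s} → s ∈ˡ ts → Nice s

  Nice-complete : Nice t → Complete (label t)
  Nice-complete (nice cpl _ _ _ _) = cpl

  Nice-honest : Nice t → Honest t
  Nice-honest (nice _ hon _ _ _) = hon

  Nice-universe : Nice t → t ∈ˡ universe (suc (n ∸ ∣ pos t ∣))
  Nice-universe {t} (nice _ _ ts∈ _ _) = node∈universe (n ∸ ∣ pos t ∣) ts∈

  Nice-path : Path t u → Nice t → Nice u
  Nice-path stay       ν                  = ν
  Nice-path (down i p) (nice _ _ _ _ νs) = Nice-path p (νs i)

  Nice-mono : Path t u → Nice t → pos t ⊆ pos u
  Nice-mono stay       ν                    = id
  Nice-mono (down i p) (nice _ _ _ strict νs) = Nice-mono p (νs i) ∘ proj₁ (strict i)

  rank-< : P ⊂ P′ → n ∸ ∣ P′ ∣ <ᴺ n ∸ ∣ P ∣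
  rank-< {P′ = P′} P⊂P′ = ∸-monoʳ-< (p⊂q⇒∣p∣<∣q∣ P⊂P′) (∣p∣≤n P′)

  -- Under `Con P` the second formula yields `at j` or the desired conclusion; given `at j`, the
  -- first formula applies. Thus labels are completed without excluded middle.
  cut : χ (node (P ∪ ⁅ j ⁆ , Q) ts) ∧ χ (node (P , Q ∪ ⁅ j ⁆) ts) ≤ χ (node (P , Q) ts)
  cut {P} {j} {Q} {ts} = curry (case-in
      (apply (fst ⨾ fst ⨾ fst) (⟨ fst ⨾ snd , snd ⨾ Con-⁅⁆ ⟩ ⨾ Con-∪ P ⁅ j ⁆)) snd
      (apply (fst ⨾ snd) snd ⨾ Δ))
    where
    Δ : Dis (Q ∪ ⁅ j ⁆) ∨ χs ts ≤ at j ∨ (Dis Q ∨ χs ts)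
    Δ = [ Dis-∪ Q ⁅ j ⁆ ⨾ [ inl ⨾ inr , Dis-⁅⁆ ⨾ inl ] , inr ⨾ inr ]

  saturate : ∀ F js →
    (∀ {P′ Q′} → P ⊆ P′ → Q ⊆ Q′ → (∀ {j} → j ∈ˡ js → j ∈ P′ ⊎ j ∈ Q′) → Mem F (χ (node (P′ , Q′) ts))) →
    Mem F (χ (node (P , Q) ts))
  saturate F [] κ = κ id id (λ ())
  saturate {P} {Q} {ts} F (j ∷ js) κ = up F (cut {P = P} {j = j} {Q = Q} {ts = ts}) (meet F
    (saturate F js λ f g d → κ (f ∘ p⊆p∪q ⁅ j ⁆) g λ where
      (here refl) → inj₁ (f (q⊆p∪q P ⁅ j ⁆ (x∈⁅x⁆ j)))
      (there i)   → d i)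
    (saturate F js λ f g d → κ f (g ∘ p⊆p∪q ⁅ j ⁆) λ where
      (here refl) → inj₂ (g (q⊆p∪q Q ⁅ j ⁆ (x∈⁅x⁆ j)))
      (there i)   → d i))

  Embeds : List (Tree n) → Tree n → Set
  Embeds es t = ∀ {e} → e ∈ˡ es → ∃[ u ] (Path t u × Sim Ext e u)

  -- Trees of es whose root asserts no more than the new root are merged with it.
  splice : Complete l → ∀ es → AllNice es → S4I (χ (node l es)) ⊎
    (∃[ ks ] (AllNice ks × (∀ {s} → s ∈ˡ ks → proj₁ l ⊂ pos s) × (χs ks ≤ χs es) ×
      (∀ {ts} → ks ⊆ˡ ts → Embeds es (node l ts))))
  splice cpl [] νs = inj₂ ([] , (λ ()) , (λ ()) , ≤-refl , λ _ ())
  splice {P , Q} cpl (e ∷ es) νs with splice cpl es (νs ∘ there)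
  ... | inj₁ p = inj₁ (mp (χ-mono {l = P , Q} inr) p)
  splice {P , Q} cpl (e@(node (Pₑ , Qₑ) ks′) ∷ es) νs | inj₂ (ks , νk , str , le , emb)
    with νs (here refl) | ⊆-or-∃ P Pₑ
  ... | nice cplₑ _ _ _ _ | inj₂ (j , j∈P , j∉Pₑ) with cplₑ j
  ...   | inj₁ j∈Pₑ = contradiction j∈Pₑ j∉Pₑ
  -- A clash: `Con P` proves `at j`, which the root of `e` denies, so `Con P` proves `χ e`.
  ...   | inj₂ j∈Qₑ = inj₁ (Con-lower j∈P ⨾ Dis-upper j∈Qₑ ⨾ inl ⨾ taut K ⨾ inl ⨾ inr)
  splice {P , Q} cpl (e@(node (Pₑ , Qₑ) ks′) ∷ es) νs | inj₂ (ks , νk , str , le , emb)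
      | nice _ _ _ strₑ νₑ | inj₁ P⊆Pₑ with ⊆-or-∃ Pₑ P
  ... | inj₂ extra = inj₂ (e ∷ ks ,
        (λ { (here refl) → νs (here refl) ; (there i) → νk i }) ,
        (λ { (here refl) → P⊆Pₑ , extra ; (there i) → str i }) ,
        ∨-mono ≤-refl le ,
        λ f → λ { (here refl) → e , down (f (here refl)) stay , Sim-refl Ext-refl e
                ; (there i) → emb (f ∘ there) i })
  -- The asserted sets agree. Completeness of the new label puts the denials of `e` into `Q` unless
  -- `χ e` is provable; the new root then adopts the children of `e`.
  ... | inj₁ Pₑ⊆P with ⊆-or-∃ Qₑ Q
  ...   | inj₂ (j , j∈Qₑ , j∉Q) with cpl j
  ...     | inj₁ j∈P = inj₁ (const (χ-clash {t = e} (P⊆Pₑ j∈P) j∈Qₑ) ⨾ inl ⨾ inr)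
  ...     | inj₂ j∈Q = contradiction j∈Q j∉Q
  splice {P , Q} cpl (e@(node (Pₑ , Qₑ) ks′) ∷ es) νs | inj₂ (ks , νk , str , le , emb)
      | nice _ _ _ strₑ νₑ | inj₁ P⊆Pₑ | inj₁ Pₑ⊆P | inj₁ Qₑ⊆Q = inj₂ (ks′ ++ ks ,
        (λ i → case ∈-++⁻ ks′ i of λ { (inj₁ i′) → νₑ i′ ; (inj₂ i′) → νk i′ }) ,
        (λ i → case ∈-++⁻ ks′ i of λ
          { (inj₁ i′) → subst (_⊂ _) (⊆-antisym Pₑ⊆P P⊆Pₑ) (strₑ i′) ; (inj₂ i′) → str i′ }) ,
        (χs-++ ks′ ks ⨾ ∨-mono (inr ⨾ taut K) le) ,
        λ f → λ { (here refl) → _ , stay , sim (Pₑ⊆P , Qₑ⊆Q) λ i →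
                    _ , down (f (∈-++⁺ˡ i)) stay , Sim-refl Ext-refl _
                ; (there i) → emb (f ∘ ∈-++⁺ʳ ks′) i })
    where
    χs-++ : ∀ ts us → χs (ts ++ us) ≤ χs ts ∨ χs us
    χs-++ []       us = inr
    χs-++ (t ∷ ts) us = [ inl ⨾ inl , χs-++ ts us ⨾ [ inr ⨾ inl , inr ] ]

  HonestAt : Fin n → Label n → List (Tree n) → Set
  HonestAt i l es = ∀ {b c} → at i ≡ (b ⇒ c) → i ∈ proj₂ l →
    Witness b c l ⊎ (∃[ e ] (e ∈ˡ es × Witness b c (label e)))

  -- A denied implication b ⇒ c is witnessed by a tree whose root asserts b on top of P; the
  -- recursion is on the number of formulas that the root does not assert.
  finish : ∀ m F → n ∸ ∣ proj₁ l ∣ <ᴺ m → Complete l → AllNice es →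
    (∀ {ts} → Nice (node l ts) → Embeds es (node l ts) → Mem F (χ (node l ts))) →
    Mem F (χ (node l es))
  addWitnesses : ∀ m F is → n ∸ ∣ proj₁ l ∣ ≤ᴺ m → Complete l → AllNice es →
    (∀ {es′} → es ⊆ˡ es′ → AllNice es′ → (∀ {i} → i ∈ˡ is → HonestAt i l es′) → Mem F (χ (node l es′))) →
    Mem F (χ (node l es))

  finish {l@(P , Q)} {es} (suc m) F (s≤s r) cpl νs κ =
    addWitnesses m F (allFin n) r cpl νs body
    where
    body : ∀ {es′} → es ⊆ˡ es′ → AllNice es′ → (∀ {i} → i ∈ˡ allFin n → HonestAt i l es′) →
           Mem F (χ (node l es′))
    body {es′} es⊆ νs′ hon with splice cpl es′ νs′
    ... | inj₁ p = theorem F p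
    ... | inj₂ (ks , νk , str , le , emb)
      with canonical-sublist {xs = ks} {universe (n ∸ ∣ P ∣)}
             (λ i → universe-mono (≤⇒≤′ (rank-< (str i))) (Nice-universe (νk i)))
    ... | ts , ts∈ , ks⊆ , ⊆ks = up F (χ-mono {l = l} (χs-mono ⊆ks ⨾ le))
          (κ (nice cpl honest ts∈ (str ∘ ⊆ks) (νk ∘ ⊆ks)) (emb ks⊆ ∘ es⊆))
      where
      honest : Honest (node l ts)
      honest {i} e i∈Q with hon (∈-allFin i) e i∈Q
      ... | inj₁ w = _ , stay , w
      ... | inj₂ (s , s∈ , w) = let u , p , σ = emb ks⊆ s∈ in u , p , Witness-Ext (Sim-label σ) w

  addWitnesses m F [] r cpl νs κ = κ id νs (λ ())
  addWitnesses {l@(P , Q)} {es} m F (i ∷ is) r cpl νs κ with imp-shape (at i) | i ∈? Q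
  ... | inj₂ ¬imp | _ = addWitnesses m F is r cpl νs λ f νs′ hon → κ f νs′ λ where
    (here refl) e → contradiction e ¬imp
    (there i′)    → hon i′
  ... | inj₁ _ | no i∉Q = addWitnesses m F is r cpl νs λ f νs′ hon → κ f νs′ λ where
    (here refl) _ i∈Q → contradiction i∈Q i∉Q
    (there i′)        → hon i′
  ... | inj₁ (b , c , e) | yes i∈Q with ⇒-closed e
  ... | (j , refl) , (k , refl) with j ∈? P
  ... | yes j∈P with cpl k
  -- The asserted `at k` already proves the denied implication.
  ...   | inj₁ k∈P = theorem F (Con-lower k∈P ⨾ taut K ⨾ subst (_≤ Dis Q) e (Dis-upper i∈Q) ⨾ inl)
  ...   | inj₂ k∈Q = addWitnesses m F is r cpl νs λ f νs′ hon → κ f νs′ λ where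
    (here refl) e′ _ → inj₁ (imp-witness e e′ j∈P k∈Q)
    (there i′)       → hon i′
  addWitnesses {l@(P , Q)} {es} m F (i ∷ is) r cpl νs κ
    | inj₁ (_ , _ , e) | yes i∈Q | (j , refl) , (k , refl) | no j∉P =
    -- The witness starts as a single node asserting `j` on top of `P` and denying `k`. It is
    -- saturated and finished, and the result joins the forest before the remaining indices are
    -- treated.
    up F drop (saturate {P = P ∪ ⁅ j ⁆} {Q = ⁅ k ⁆} {ts = []} G (allFin n) λ {P′} {Q′} f g d →
      finish m G (≤ᴺ-trans (rank-< (f ∘ p⊆p∪q ⁅ j ⁆ , j , j∈ f , j∉P)) r) (λ x → d (∈-allFin x)) (λ ())
        λ {ts} ν _ → addWitnesses {es = node (P′ , Q′) ts ∷ es} m F is r cpl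
          (λ { (here refl) → ν ; (there s∈) → νs s∈ })
          λ h νs′ hon → κ (h ∘ there) νs′ λ where
            (here refl) e′ _ → inj₂ (_ , h (here refl) , imp-witness e e′ (j∈ f) (g (x∈⁅x⁆ k)))
            (there i′)       → hon i′)
    where
    -- Unfolded, `χ t` lies in `G` exactly when `χ (node l (t ∷ es))` lies in `F`.
    G : Filter
    G = joinʳ (χs es) (joinˡ (Dis Q) (residual (Con P) F))
    j∈ : ∀ {P′} → P ∪ ⁅ j ⁆ ⊆ P′ → j ∈ P′
    j∈ f = f (q⊆p∪q P ⁅ j ⁆ (x∈⁅x⁆ j))
    denied : Con P ∧ χ (node (P ∪ ⁅ j ⁆ , ⁅ k ⁆) []) ≤ Dis Q
    denied = curry (apply (fst ⨾ snd) (⟨ fst ⨾ fst , snd ⨾ Con-⁅⁆ ⟩ ⨾ Con-∪ P ⁅ j ⁆) ⨾ [ Dis-⁅⁆ , ⊥-min ])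
      ⨾ subst (_≤ Dis Q) e (Dis-upper i∈Q)
    -- The starting node adds nothing: under `Con P` its formula proves the denied implication,
    -- hence `Dis Q`.
    drop : Con P ⇒ (Dis Q ∨ (χ (node (P ∪ ⁅ j ⁆ , ⁅ k ⁆) []) ∨ χs es)) ≤ χ (node l es)
    drop = curry (case-in (snd ⨾ inl)
      (case-in (⟨ fst ⨾ fst ⨾ snd , snd ⟩ ⨾ denied ⨾ inl) (snd ⨾ inr) snd) (apply fst snd))

  -- The children are completed first; the root label is then saturated over their completions, and
  -- `finish` reconciles the two levels.
  complete : ∀ F t → (∀ {e} → Sim Ext t e → Nice e → Mem F (χ e)) → Mem F (χ t)
  completes : ∀ F ts →
    (∀ {es} → AllNice es → (∀ {s} → s ∈ˡ ts → ∃[ e ] (e ∈ˡ es × Sim Ext s e)) → Mem F (χs es)) →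
    Mem F (χs ts)
  -- In the filter passed to `completes`, membership of `χs ts` unfolds to membership of
  -- `χ (node (P , Q) ts)` in `F`.
  complete F (node (P , Q) ts) κ = completes (joinˡ (Dis Q) (residual (Con P) F)) ts λ {es} νs σ →
    saturate {ts = es} F (allFin n) λ {P′} f g d →
      finish (suc n) F (s≤s (m∸n≤m n ∣ P′ ∣)) (λ i → d (∈-allFin i)) νs λ ν emb →
        κ (sim (f , g) λ i →
             let _ , e∈ , ρ = σ i
                 u , p , τ  = emb e∈
             in u , p , Sim-trans Ext-trans ρ τ)
          ν
  completes F [] κ = κ {[]} (λ ()) (λ ())
  completes F (t ∷ ts) κ = complete (joinʳ (χs ts) F) t λ {e} σ ν →
    completes (joinˡ (χ e) F) ts λ {es} νs τ →
      κ {e ∷ es} (λ { (here refl) → ν ; (there i) → νs i }) λ where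
        (here refl) → e , here refl , σ
        (there i)   → let e′ , e′∈ , ρ = τ i in e′ , there e′∈ , ρ

  -- Nice trees with unprovable characteristic formula

  Good : Tree n → Set
  Good t = ¬ S4I (χ t) × Nice t

  good-completion : ∀ t → ¬ S4I (χ t) → ¬ ¬ (∃[ e ] (Sim Ext t e × Good e))
  good-completion t ⊬t none = complete notRefutable t (λ σ ν ⊬e → none (_ , σ , ⊬e , ν)) ⊬t

  Good-path : Path t u → Good t → Good u
  Good-path p (⊬t , ν) = ⊬t ∘ mp (χ-path p) , Nice-path p ν

  Good-consistent : Good t → ¬ (Con (pos t) ≤ Dis (neg t))
  Good-consistent {node _ _} (⊬t , _) f = ⊬t (f ⨾ inl)

  Good-pos : Good t → Con (pos t) ≤ at j → j ∈ pos t
  Good-pos {j = j} g f with Nice-complete (proj₂ g) j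
  ... | inj₁ j∈P = j∈P
  ... | inj₂ j∈Q = contradiction (f ⨾ Dis-upper j∈Q) (Good-consistent g)

  Good-neg : Good t → at j ≤ Dis (neg t) → j ∈ neg t
  Good-neg {j = j} g f with Nice-complete (proj₂ g) j
  ... | inj₁ j∈P = contradiction (Con-lower j∈P ⨾ f) (Good-consistent g)
  ... | inj₂ j∈Q = j∈Q

  Good-universe : Good t → t ∈ˡ universe (suc n)
  Good-universe {t} (_ , ν) = universe-mono (≤⇒≤′ (s≤s (m∸n≤m n ∣ pos t ∣))) (Nice-universe ν)

  -- The finite model

  -- A position rather than a subtree: goodness and the modal relation refer to the root and to the
  -- path from it.
  record World : Set where
    constructor world
    field
      {root tip} : Tree n
      path       : Path root tip

  open World

  private variable
    x y z : World

  infix 4 _≼ʷ_ _⊑ʷ_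

  data _≼ʷ_ : Rel World 0ℓ where
    extend : (p : Path t u) (q : Path u v) → world p ≼ʷ world (p ∙ q)

  -- Goodness is not decided, so it is handed on as an implication; the relation stays a preorder on
  -- all positions, good or not.
  _⊑ʷ_ : Rel World 0ℓ
  x ⊑ʷ y = Match Mod (path x) (path y) × (Good (root x) → Good (root y))

  ≼ʷ-refl : Reflexive _≼ʷ_
  ≼ʷ-refl {world p} = subst (λ q → world p ≼ʷ world q) (∙-identityʳ p) (extend p stay)

  ≼ʷ-trans : Transitive _≼ʷ_
  ≼ʷ-trans (extend p q) (extend _ r) =
    subst (λ s → world p ≼ʷ world s) (sym (∙-assoc p q r)) (extend p (q ∙ r))

  ⊑ʷ-refl : Reflexive _⊑ʷ_
  ⊑ʷ-refl {world p} = Match-refl (λ {l} → Mod-refl {l}) p , id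

  ⊑ʷ-trans : Transitive _⊑ʷ_
  ⊑ʷ-trans (m , f) (m′ , f′) = Match-trans (λ {l} {l′} {l″} → Mod-trans {l} {l′} {l″}) m m′ , f′ ∘ f

  ≼ʷ-root : x ≼ʷ y → root x ≡ root y
  ≼ʷ-root (extend _ _) = refl

  ≼ʷ-pos : Good (root x) → x ≼ʷ y → pos (tip x) ⊆ pos (tip y)
  ≼ʷ-pos g (extend p q) = Nice-mono q (proj₂ (Good-path p g))

  ⊑ʷ-Mod : x ⊑ʷ y → Mod (label (tip x)) (label (tip y))
  ⊑ʷ-Mod (m , _) = Match-tip m

  ⊑ʷ-forward : x ≼ʷ y → x ⊑ʷ z → ∃[ z′ ] (z ≼ʷ z′ × y ⊑ʷ z′)
  ⊑ʷ-forward (extend p q) (m , f) =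
    let _ , r , m′ = Match-extend m q in _ , extend _ r , m′ , f

  ⊑ʷ-downward : x ≼ʷ y → y ⊑ʷ z → ∃[ x′ ] (x ⊑ʷ x′ × x′ ≼ʷ z)
  ⊑ʷ-downward (extend p q) (m , f) with Match-prefix p m
  ... | _ , q₁ , q₂ , refl , m′ = world q₁ , (m′ , f) , extend q₁ q₂

  worldsOf : Tree n → List World
  worldsOf t = map (λ (_ , p) → world p) (paths t)

  worlds : List World
  worlds = concatMap worldsOf (universe (suc n))

  ∈-worlds : (p : Path t u) → t ∈ˡ universe (suc n) → world p ∈ˡ worlds
  ∈-worlds p t∈ = ∈-concatMap⁺ worldsOf (Any.map (λ { refl → ∈-map⁺ _ (∈-paths p) }) t∈)

  root∈universe : x ∈ˡ worlds → root x ∈ˡ universe (suc n)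
  root∈universe x∈ = Any.map f (∈-concatMap⁻ worldsOf x∈)
    where
    f : ∀ {t} → x ∈ˡ worldsOf t → root x ≡ t
    f {t} i with ∈-map⁻ _ i
    ... | _ , _ , refl = refl

  W′ : Set
  W′ = Fin (length worlds)

  ⟪_⟫ : W′ → World
  ⟪_⟫ = lookup worlds

  code : root x ∈ˡ universe (suc n) → ∃[ w ] ⟪ w ⟫ ≡ x
  code {world p} t∈ = index x∈ , sym (lookup-index x∈)
    where x∈ = ∈-worlds p t∈

  -- Being listed depends only on the root, so the confluence witnesses, which share their root with
  -- a listed world, are worlds too.
  code-root : ∀ w → root x ≡ root ⟪ w ⟫ → ∃[ v ] ⟪ v ⟫ ≡ x
  code-root w e = code (subst (_∈ˡ universe (suc n)) (sym e) (root∈universe (∈-lookup w)))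

  model : Model
  model = record
    { frame = record
      { W            = W′
      ; W⊥           = λ _ → ⊥
      ; _≼_          = λ w v → ⟪ w ⟫ ≼ʷ ⟪ v ⟫
      ; _⊑_          = λ w v → ⟪ w ⟫ ⊑ʷ ⟪ v ⟫
      ; ≼-isPreorder = record
        { isEquivalence = isEquivalence ; reflexive = λ { refl → ≼ʷ-refl } ; trans = ≼ʷ-trans }
      ; ⊑-isPreorder = record
        { isEquivalence = isEquivalence ; reflexive = λ { refl → ⊑ʷ-refl } ; trans = ⊑ʷ-trans }
      ; W⊥-≼-upward  = λ _ ()
      ; W⊥-⊑-upward  = λ _ ()
      }
    -- Goodness of the root makes the valuation upward closed, since asserted sets are known to grow
    -- along paths of nice trees.
    ; V          = λ p w → Good (root ⟪ w ⟫) × (∃[ i ] (at i ≡ var p × i ∈ pos (tip ⟪ w ⟫)))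
    ; V-≼-upward = λ p w≼v (g , i , e , i∈) →
        subst Good (≼ʷ-root w≼v) g , i , e , ≼ʷ-pos g w≼v i∈
    ; W⊥⊆V       = λ p ()
    }

  open Model model using (_≼_; _⊑_)
  open Satisfaction model

  model-isS4I : IsS4IModel model
  model-isS4I = record
    { infallible        = λ _ ()
    ; forwardConfluent  = λ {w} {w′} {v} w≼w′ w⊑v →
        let z , v≼z , w′⊑z = ⊑ʷ-forward w≼w′ w⊑v
            z′ , e         = code-root v (sym (≼ʷ-root v≼z))
        in z′ , subst (⟪ v ⟫ ≼ʷ_) (sym e) v≼z , subst (⟪ w′ ⟫ ⊑ʷ_) (sym e) w′⊑z
    ; downwardConfluent = λ {w} {v} {v′} w≼v v⊑v′ →
        let z , w⊑z , z≼v′ = ⊑ʷ-downward w≼v v⊑v′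
            z′ , e         = code-root v′ (≼ʷ-root z≼v′)
        in z′ , subst (⟪ w ⟫ ⊑ʷ_) (sym e) w⊑z , subst (_≼ʷ ⟪ v′ ⟫) (sym e) z≼v′
    }

  -- Modal successors and the truth lemma

  P⟨_⟩ Q⟨_⟩ : W′ → Subset n
  P⟨ w ⟩ = pos (tip ⟪ w ⟫)
  Q⟨ w ⟩ = neg (tip ⟪ w ⟫)

  -- Were `χ` of the marked tree provable, necessitation and `□χ-mark` would prove `χ` of the root.
  -- So a good completion exists up to double negation, and lifting the marked path into it gives
  -- the successor.
  modal-successor : ∀ w l → Good (root ⟪ w ⟫) → Admissible (label (tip ⟪ w ⟫)) l →
                    ¬ ¬ (∃[ v ] (w ⊑ v × Ext l (label (tip ⟪ v ⟫))))
  modal-successor w l (⊬t , _) adm none =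
    good-completion (mark p l) (λ ⊢mark → ⊬t (mp (□χ-mark p adm) (nec ⊢mark))) λ (e , σ , g) →
      let _ , q , m     = Match-lift σ (markPath p l)
          v , eq        = code {world q} (Good-universe g)
          f , f′        = Match-tip m
          M₊ , M₋       = modalPart (label (tip ⟪ w ⟫))
      in none (v , subst (λ x → ⟪ w ⟫ ⊑ʷ x × Ext l (label (tip x))) (sym eq)
           ( ( Match-trans (λ {l} {l′} {l″} → Mod-Ext-trans {l} {l′} {l″}) (mark-match p l) m
             , λ _ → g)
           , f ∘ q⊆p∪q M₊ (proj₁ l) , f′ ∘ q⊆p∪q M₋ (proj₂ l)))
    where p = path ⟪ w ⟫

  ◇Successors □Successors : Set
  ◇Successors = ∀ w i j → Good (root ⟪ w ⟫) → at i ≡ (◇ at j) → i ∈ P⟨ w ⟩ → ∃[ v ] (w ⊑ v × j ∈ P⟨ v ⟩)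
  □Successors = ∀ w i j → Good (root ⟪ w ⟫) → at i ≡ (□ at j) → i ∈ Q⟨ w ⟩ → ∃[ v ] (w ⊑ v × j ∈ Q⟨ v ⟩)

  ¬¬-premises : {A B C D : Set} → (A → B → C → ¬ ¬ D) → ¬ ¬ (A → B → C → D)
  ¬¬-premises f k = k λ a b c → ⊥-elim (f a b c λ d → k λ _ _ _ → d)

  -- Worlds and indices form finite types, so the double negation moves outside all quantifiers at
  -- once.
  ◇-successors : ¬ ¬ ◇Successors
  ◇-successors = ¬¬-∀Fin λ w → ¬¬-∀Fin λ i → ¬¬-∀Fin λ j → ¬¬-premises λ g e i∈ none →
    modal-successor w (⁅ j ⁆ , ∅ˢ) g (◇-admissible e i∈) λ (v , w⊑v , f , _) →
      none (v , w⊑v , f (x∈⁅x⁆ j))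

  □-successors : ¬ ¬ □Successors
  □-successors = ¬¬-∀Fin λ w → ¬¬-∀Fin λ i → ¬¬-∀Fin λ j → ¬¬-premises λ g e i∈ none →
    modal-successor w (∅ˢ , ⁅ j ⁆) g (□-admissible e i∈) λ (v , w⊑v , _ , f) →
      none (v , w⊑v , f (x∈⁅x⁆ j))

  -- Both halves are carried along because the implication case uses each with the opposite sign.
  Truth : Formula → Set
  Truth ψ = ∀ w {i} → Good (root ⟪ w ⟫) → at i ≡ ψ → (i ∈ P⟨ w ⟩ → w ⊩ ψ) × (i ∈ Q⟨ w ⟩ → ¬ (w ⊩ ψ))

  module _ (◇succ : ◇Successors) (□succ : □Successors) where

    truth-var : ∀ {p} → Truth (var p)
    truth-var w g e =
      (λ i∈P → g , _ , e , i∈P) ,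
      -- `j` may be a different index of the same variable, so the clash comes from derivability.
      (λ i∈Q (_ , j , e′ , j∈P) → Good-consistent (Good-path (path ⟪ w ⟫) g)
        (Con-lower j∈P ⨾ ≤-reflexive (trans e′ (sym e)) ⨾ Dis-upper i∈Q))

    truth-⊥ : Truth ⊥'
    truth-⊥ w g e =
      (λ i∈P → Good-consistent (Good-path (path ⟪ w ⟫) g) (Con-lower i∈P ⨾ ≤-reflexive e ⨾ ⊥-min)) ,
      (λ _ ())

    truth-∧ : Truth a → Truth b → Truth (a ∧ b)
    truth-∧ A B w g e with ∧-closed e
    ... | (j , refl) , (k , refl) =
      (λ i∈P → proj₁ (A w g refl) (Good-pos g′ (Con-lower i∈P ⨾ ≤-reflexive e ⨾ fst)) ,
               proj₁ (B w g refl) (Good-pos g′ (Con-lower i∈P ⨾ ≤-reflexive e ⨾ snd))) ,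
      λ i∈Q (wa , wb) → case Nice-complete (proj₂ g′) j of λ where
        (inj₂ j∈Q) → proj₂ (A w g refl) j∈Q wa
        (inj₁ j∈P) → case Nice-complete (proj₂ g′) k of λ where
          (inj₂ k∈Q) → proj₂ (B w g refl) k∈Q wb
          (inj₁ k∈P) → Good-consistent g′
            (⟨ Con-lower j∈P , Con-lower k∈P ⟩ ⨾ ≤-reflexive (sym e) ⨾ Dis-upper i∈Q)
      where g′ = Good-path (path ⟪ w ⟫) g

    truth-∨ : Truth a → Truth b → Truth (a ∨ b)
    truth-∨ A B w g e with ∨-closed e
    ... | (j , refl) , (k , refl) =
      (λ i∈P → case Nice-complete (proj₂ g′) j of λ where
        (inj₁ j∈P) → inj₁ (proj₁ (A w g refl) j∈P)
        (inj₂ j∈Q) → case Nice-complete (proj₂ g′) k of λ where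
          (inj₁ k∈P) → inj₂ (proj₁ (B w g refl) k∈P)
          (inj₂ k∈Q) → ⊥-elim (Good-consistent g′
            (Con-lower i∈P ⨾ ≤-reflexive e ⨾ [ Dis-upper j∈Q , Dis-upper k∈Q ]))) ,
      λ i∈Q → λ where
        (inj₁ wa) → proj₂ (A w g refl)
          (Good-neg g′ (inl ⨾ ≤-reflexive (sym e) ⨾ Dis-upper i∈Q)) wa
        (inj₂ wb) → proj₂ (B w g refl)
          (Good-neg g′ (inr ⨾ ≤-reflexive (sym e) ⨾ Dis-upper i∈Q)) wb
      where g′ = Good-path (path ⟪ w ⟫) g

    truth-⇒ : Truth a → Truth b → Truth (a ⇒ b)
    truth-⇒ {a} {b} A B w {i} g e with ⇒-closed e
    ... | (j , ej) , (k , ek) = forces , refutes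
      where
      forces : i ∈ P⟨ w ⟩ → w ⊩ a ⇒ b
      forces i∈P v w≼v va = case Nice-complete (proj₂ gv′) j of λ where
          (inj₂ j∈Q) → contradiction va (proj₂ (A v gv ej) j∈Q)
          (inj₁ j∈P) → proj₁ (B v gv ek)
            (Good-pos gv′ (apply (Con-lower (≼ʷ-pos g w≼v i∈P) ⨾ ≤-reflexive e) (Con-lower j∈P ⨾ ≤-reflexive ej)
               ⨾ ≤-reflexive (sym ek)))
        where
        gv  = subst Good (≼ʷ-root w≼v) g
        gv′ = Good-path (path ⟪ v ⟫) gv
      refutes : i ∈ Q⟨ w ⟩ → ¬ (w ⊩ a ⇒ b)
      refutes i∈Q wab =
        let u , r , j′ , k′ , ej′ , ek′ , j∈P , k∈Q = Nice-honest (proj₂ (Good-path (path ⟪ w ⟫) g)) e i∈Q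
            v , eq = code-root {world (path ⟪ w ⟫ ∙ r)} w refl
            gv     = subst (Good ∘ root) (sym eq) g
        in proj₂ (B v gv ek′) (subst (λ x → k′ ∈ neg (tip x)) (sym eq) k∈Q)
             (wab v (subst (⟪ w ⟫ ≼ʷ_) (sym eq) (extend _ r))
               (proj₁ (A v gv ej′) (subst (λ x → j′ ∈ pos (tip x)) (sym eq) j∈P)))

    truth-◇ : Truth a → Truth (◇ a)
    truth-◇ {a} A w {i} g e with ◇-closed e
    ... | j , refl = forces , refutes
      where
      forces : i ∈ P⟨ w ⟩ → w ⊩ ◇ a
      forces i∈P u w≼u =
        let gu            = subst Good (≼ʷ-root w≼u) g
            v , u⊑v , j∈P = ◇succ u i j gu e (≼ʷ-pos g w≼u i∈P)
        in v , u⊑v , proj₁ (A v (proj₂ u⊑v gu) refl) j∈P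
      refutes : i ∈ Q⟨ w ⟩ → ¬ (w ⊩ ◇ a)
      refutes i∈Q w◇a =
        -- The denied diamond persists to `v`, where `T◇` makes `a` denied as well.
        let v , w⊑v , va = w◇a w ≼ʷ-refl
            gv           = proj₂ w⊑v g
            i∈dias       = ∈-tabulate⁺ (cong isDia e)
        in proj₂ (A v gv refl) (Good-neg (Good-path (path ⟪ v ⟫) gv)
             (T◇ ⨾ ≤-reflexive (sym e) ⨾ Dis-upper (proj₂ (⊑ʷ-Mod w⊑v) (x∈p∩q⁺ (i∈Q , i∈dias))))) va

    truth-□ : Truth a → Truth (□ a)
    truth-□ {a} A w {i} g e with □-closed e
    ... | j , refl = forces , refutes
      where
      forces : i ∈ P⟨ w ⟩ → w ⊩ □ a
      forces i∈P u v w≼u u⊑v =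
        let gv      = proj₂ u⊑v (subst Good (≼ʷ-root w≼u) g)
            i∈boxes = ∈-tabulate⁺ (cong isBox e)
        in proj₁ (A v gv refl) (Good-pos (Good-path (path ⟪ v ⟫) gv)
             (Con-lower (proj₁ (⊑ʷ-Mod u⊑v) (x∈p∩q⁺ (≼ʷ-pos g w≼u i∈P , i∈boxes))) ⨾ ≤-reflexive e ⨾ T□))
      refutes : i ∈ Q⟨ w ⟩ → ¬ (w ⊩ □ a)
      refutes i∈Q w□a =
        let v , w⊑v , j∈Q = □succ w i j g e i∈Q
        in proj₂ (A v (proj₂ w⊑v g) refl) j∈Q (w□a w v ≼ʷ-refl w⊑v)

    truth : ∀ ψ → Truth ψ
    truth (var p) = truth-var
    truth ⊥'      = truth-⊥
    truth (a ∧ b) = truth-∧ (truth a) (truth b)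
    truth (a ∨ b) = truth-∨ (truth a) (truth b)
    truth (a ⇒ b) = truth-⇒ (truth a) (truth b)
    truth (◇ a)   = truth-◇ (truth a)
    truth (□ a)   = truth-□ (truth a)

  model-refutes : ∀ i → at i ∉ S4I → ¬ (model ⊨ at i)
  model-refutes i ⊬ valid =
    ◇-successors λ ◇succ → □-successors λ □succ →
      -- The single node denying only `at i` has a characteristic formula that entails `at i`.
      good-completion (node (∅ˢ , ⁅ i ⁆) []) (λ p → ⊬ (mp ([ Dis-⁅⁆ , ⊥-min ]) (mp p Con-∅)))
        λ (t , σ , g) →
          let w , eq = code {world (stay {t = t})} (Good-universe g)
          in proj₂ (truth ◇succ □succ (at i) w (subst (Good ∘ root) (sym eq) g) refl)
               (subst (λ x → i ∈ neg (tip x)) (sym eq) (proj₂ (Sim-label σ) (x∈⁅x⁆ i)))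
               (valid w (λ ()))

-- Subformulas

subformulas : Formula → List Formula
properSubformulas : Formula → List Formula
subformulas a = a ∷ properSubformulas a
properSubformulas (var _) = []
properSubformulas ⊥'      = []
properSubformulas (a ∧ b) = subformulas a ++ subformulas b
properSubformulas (a ∨ b) = subformulas a ++ subformulas b
properSubformulas (a ⇒ b) = subformulas a ++ subformulas b
properSubformulas (◇ a)   = subformulas a
properSubformulas (□ a)   = subformulas a

subformulas-trans : ∀ c → b ∈ˡ subformulas c → subformulas b ⊆ˡ subformulas c
properSubformulas-trans : ∀ c → b ∈ˡ properSubformulas c → subformulas b ⊆ˡ properSubformulas c
subformulas-trans c (here refl) = id
subformulas-trans c (there i)   = there ∘ properSubformulas-trans c i
properSubformulas-trans (c ∧ d) i with ∈-++⁻ (subformulas c) i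
... | inj₁ i′ = ∈-++⁺ˡ ∘ subformulas-trans c i′
... | inj₂ i′ = ∈-++⁺ʳ (subformulas c) ∘ subformulas-trans d i′
properSubformulas-trans (c ∨ d) i with ∈-++⁻ (subformulas c) i
... | inj₁ i′ = ∈-++⁺ˡ ∘ subformulas-trans c i′
... | inj₂ i′ = ∈-++⁺ʳ (subformulas c) ∘ subformulas-trans d i′
properSubformulas-trans (c ⇒ d) i with ∈-++⁻ (subformulas c) i
... | inj₁ i′ = ∈-++⁺ˡ ∘ subformulas-trans c i′
... | inj₂ i′ = ∈-++⁺ʳ (subformulas c) ∘ subformulas-trans d i′
properSubformulas-trans (◇ c) i = subformulas-trans c i
properSubformulas-trans (□ c) i = subformulas-trans c i

module _ (φ : Formula) where

  subformula : Fin (length (subformulas φ)) → Formula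
  subformula = lookup (subformulas φ)

  closed-under : ∀ i → subformula i ≡ a → b ∈ˡ properSubformulas a → ∃[ j ] subformula j ≡ b
  closed-under i refl b∈ = index b∈φ , sym (lookup-index b∈φ)
    where b∈φ = subformulas-trans φ (∈-lookup i) (there b∈)

  subformula-closed : SubformulaClosed subformula
  subformula-closed = record
    { ∧-closed = λ {a} {_} {i} e → closed-under i e (here refl) , closed-under i e (∈-++⁺ʳ (subformulas a) (here refl))
    ; ∨-closed = λ {a} {_} {i} e → closed-under i e (here refl) , closed-under i e (∈-++⁺ʳ (subformulas a) (here refl))
    ; ⇒-closed = λ {a} {_} {i} e → closed-under i e (here refl) , closed-under i e (∈-++⁺ʳ (subformulas a) (here refl))
    ; ◇-closed = λ {_} {i} e → closed-under i e (here refl)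
    ; □-closed = λ {_} {i} e → closed-under i e (here refl)
    }

mainTheorem3 : (φ : Formula) → φ ∉ S4I →
    Σ[ M ∈ Model ] (IsS4IModel M × Finite (Model.W M) × ¬ (M ⊨ φ))
-- Index `zero` is `φ` itself, the head of its list of subformulas.
mainTheorem3 φ ⊬φ = model , model-isS4I , (_ , ↔-id _) , model-refutes zero ⊬φ
  where open Construction (subformula φ) (subformula-closed φ)
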